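{- Let $\langle A,k_1,\dots,k_{i_A}\rangle$ and $\langle B,\lambda_1,\dots,\lambda_{i_B}\rangle$ be parameterized problems such that $\langle A,k_1,\dots,k_{i_A}\rangle\le_{PFG}\langle B,\lambda_1,\dots,\lambda_{i_B}\rangle$ via mappings $g_j$, and let $\Lambda\subseteq\{\lambda_1,\dots,\lambda_{i_B}\}$ be such that $FPI(B,\Lambda)$. Then $FPI(A,K_\Lambda)$, where $K_\Lambda$ is the minimum necessary set of $\Lambda$ with respect to $g$.
   Context: Problems $A,B$ have conjectured best running times $a(n),b(n)$. A parameterized problem $\langle L,k_1,\dots,k_\ell\rangle$ is a language $L$ with computable parameterization functions $k_i$ from inputs to $\mathbb{N}$. PFGR: $\langle A,k_1,\dots,k_{i_A}\rangle\le_{PFG}\langle B,\lambda_1,\dots,\lambda_{i_B}\rangle$ if there is an algorithm $R$ such that (1) for every $\varepsilon>0$ there is $\delta>0$ such that $R$ runs in $a^{1-\delta}(n)$ time on inputs $I_A$ of length $n$, making $q$ queries to $\langle B\rangle$ of lengths $n_1,\dots,n_q$ with $\sum_{i=1}^q b^{1-\varepsilon}(n_i)\le c\cdot a^{1-\delta}(n)$ for a constant $c>0$, and $R$ accepts iff $I_A\in\langle A\rangle$; and (2) for each query $q_j$ there is a computable $g_j=(g_{j,1},\dots,g_{j,i_B}):\mathbb{N}^{i_A}\to\mathbb{N}^{i_B}$ with $\lambda_i\le g_{j,i}(k_1,\dots,k_{i_A})$ for every $i$ (parameters of the $j$-th query instance bounded in terms of the parameters of $I_A$). FPI: for a set $K=\{k_1,\dots,k_x\}$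 of parameters of a problem $A$, $FPI(A,K)$ means there is an algorithm solving $A$ in time $O(a^{1-\varepsilon}(n)f(k_1,\dots,k_x))$ for some $\varepsilon>0$ and computable $f$. Minimum necessary set: $K_\Lambda$ is the minimum set $\{k_1,\dots,k_x\}$ of parameters of $A$ needed to bound the parameters in $\Lambda$ through $g$, i.e., such that there is a computable function $h$ with $g_{j,i}(k_1,\dots,k_{i_A})\le h(k_1,\dots,k_x)$ for the parameters $\lambda_i\in\Lambda$ and all $j\in[q]$. -}

module Defs where

open import Data.Bool using (Bool; true; false; if_then_else_)
open import Data.Empty using (⊥)
open import Data.Fin using (Fin; zero; suc; toℕ)
open import Data.Fin.Subset using (Subset; inside; outside; _∈_; ∣_∣)
open import Data.Integer using () renaming (∣_∣ to abs)
open import Data.List as List using (List; []; _∷_; _++_; _∷ʳ_; length; upTo; filter)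
open import Data.Nat using (ℕ; zero; suc; _+_; _*_; _∸_; _^_; _≤_; _<_; _<?_; _≟_; ⌊_/2⌋)
open import Data.Nat.ListAction using (sum)
open import Data.Product using (∃-syntax; Σ-syntax; _×_)
open import Data.Rational using (ℚ; 0ℚ; 1ℚ; ↥_; ↧ₙ_) renaming (_<_ to _<ℚ_; _-_ to _-ℚ_)
open import Data.Vec as Vec using (Vec; []; _∷_)
open import Data.Vec.Functional using (Vector; updateAt)
open import Data.Vec.Relation.Binary.Pointwise.Inductive using (Pointwise)
open import Function using (const; _⇔_)
open import Relation.Binary.PropositionalEquality using (_≡_; _≢_)
open import Relation.Nullary using (does; Reflects)

Word : Set
Word = List Bool

Language : Set₁
Language = Word → Set

-- Computability on tuples of naturals is total μ-recursiveness.

data Rec : ℕ → Set where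
  zeroᶠ : ∀ {n} → Rec n
  sucᶠ  : Rec 1
  proj  : ∀ {n} → Fin n → Rec n
  comp  : ∀ {m n} → Rec m → Vec (Rec n) m → Rec n
  prec  : ∀ {n} → Rec n → Rec (suc (suc n)) → Rec (suc n)
  mu    : ∀ {n} → Rec (suc n) → Rec n

infix 4 _[_]⇓_

data _[_]⇓_ : ∀ {n} → Rec n → Vec ℕ n → ℕ → Set where
  ⇓zero : ∀ {n} {xs : Vec ℕ n} → zeroᶠ [ xs ]⇓ 0
  ⇓suc  : ∀ {x} → sucᶠ [ x ∷ [] ]⇓ suc x
  ⇓proj : ∀ {n} {xs : Vec ℕ n} {i} → proj i [ xs ]⇓ Vec.lookup xs i
  ⇓comp : ∀ {m n} {f : Rec m} {gs : Vec (Rec n) m} {xs ys z} →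
          Pointwise (λ g y → g [ xs ]⇓ y) gs ys → f [ ys ]⇓ z →
          comp f gs [ xs ]⇓ z
  ⇓prec-zero : ∀ {n} {f : Rec n} {g xs z} →
          f [ xs ]⇓ z → prec f g [ 0 ∷ xs ]⇓ z
  ⇓prec-suc : ∀ {n} {f : Rec n} {g xs k y z} →
          prec f g [ k ∷ xs ]⇓ y → g [ k ∷ y ∷ xs ]⇓ z →
          prec f g [ suc k ∷ xs ]⇓ z
  ⇓mu   : ∀ {n} {f : Rec (suc n)} {xs k} →
          (∀ i → i < k → ∃[ y ] f [ i ∷ xs ]⇓ suc y) → f [ k ∷ xs ]⇓ 0 →
          mu f [ xs ]⇓ k

Computable : ∀ {n} → (Vec ℕ n → ℕ) → Set
Computable {n} f = Σ[ p ∈ Rec n ] (∀ xs → p [ xs ]⇓ f xs)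

-- The bijection between words and ℕ given by bijective base 2.
code : Word → ℕ
code []          = 0
code (false ∷ w) = 1 + 2 * code w
code (true  ∷ w) = 2 + 2 * code w

ComputableOnWords : (Word → ℕ) → Set
ComputableOnWords f =
  Σ[ φ ∈ (Vec ℕ 1 → ℕ) ] Computable φ × (∀ w → f w ≡ φ (code w ∷ []))

-- Algorithms: uniform-cost random access machines with addition,
-- subtraction and halving, presented as structured programs over finitely
-- many registers and finitely many unbounded arrays.  The input is
-- read-only with random access.  Oracle programs write a query letter by
-- letter on a write-only oracle tape, which is erased when it is submitted.

data Mode : Set where
  plain oracle : Mode

data Cmd (r m : ℕ) : Mode → Set where
  skip        : ∀ {κ} → Cmd r m κ
  set         : ∀ {κ} → Fin r → ℕ → Cmd r m κ
  add sub     : ∀ {κ} → Fin r → Fin r → Fin r → Cmd r m κ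
  half        : ∀ {κ} → Fin r → Fin r → Cmd r m κ
  load        : ∀ {κ} → Fin r → Fin m → Fin r → Cmd r m κ
  store       : ∀ {κ} → Fin m → Fin r → Fin r → Cmd r m κ
  read        : ∀ {κ} → Fin r → Fin r → Cmd r m κ
  inputLength : ∀ {κ} → Fin r → Cmd r m κ
  _⨾_         : ∀ {κ} → Cmd r m κ → Cmd r m κ → Cmd r m κ
  ifNZ        : ∀ {κ} → Fin r → Cmd r m κ → Cmd r m κ → Cmd r m κ
  whileNZ     : ∀ {κ} → Fin r → Cmd r m κ → Cmd r m κ
  emit        : Fin r → Cmd r m oracle
  query       : Fin r → Cmd r m oracle

record Config (r m : ℕ) : Set where
  constructor ⟨_,_,_⟩
  field
    regs   : Vector ℕ r
    arrays : Vector (ℕ → ℕ) m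
    tape   : Word

_[_≔_] : ∀ {A : Set} {n} → Vector A n → Fin n → A → Vector A n
xs [ i ≔ v ] = updateAt xs i (const v)

write : (ℕ → ℕ) → ℕ → ℕ → (ℕ → ℕ)
write a i v j = if does (j ≟ i) then v else a j

-- 0 signals a position beyond the end of the input.
letter : Word → ℕ → ℕ
letter []          _       = 0
letter (false ∷ _) zero    = 1
letter (true  ∷ _) zero    = 2
letter (_     ∷ w) (suc i) = letter w i

nonZero : ℕ → Bool
nonZero zero    = false
nonZero (suc _) = true

-- Exec O w c s s′ t qs: with oracle O and input w, the command c started in
-- s terminates in s′ after t steps, having submitted the queries qs in order.
data Exec (O : Language) (w : Word) {r m : ℕ} :
          ∀ {κ} → Cmd r m κ → Config r m → Config r m → ℕ → List Word → Set where
  e-skip  : ∀ {κ s} → Exec O w {κ = κ} skip s s 0 []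
  e-set   : ∀ {κ ρ α τ x k} →
            Exec O w {κ = κ} (set x k) ⟨ ρ , α , τ ⟩ ⟨ ρ [ x ≔ k ] , α , τ ⟩ 1 []
  e-add   : ∀ {κ ρ α τ x y z} →
            Exec O w {κ = κ} (add x y z) ⟨ ρ , α , τ ⟩ ⟨ ρ [ x ≔ ρ y + ρ z ] , α , τ ⟩ 1 []
  e-sub   : ∀ {κ ρ α τ x y z} →
            Exec O w {κ = κ} (sub x y z) ⟨ ρ , α , τ ⟩ ⟨ ρ [ x ≔ ρ y ∸ ρ z ] , α , τ ⟩ 1 []
  e-half  : ∀ {κ ρ α τ x y} →
            Exec O w {κ = κ} (half x y) ⟨ ρ , α , τ ⟩ ⟨ ρ [ x ≔ ⌊ ρ y /2⌋ ] , α , τ ⟩ 1 []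
  e-load  : ∀ {κ ρ α τ x a y} →
            Exec O w {κ = κ} (load x a y) ⟨ ρ , α , τ ⟩ ⟨ ρ [ x ≔ α a (ρ y) ] , α , τ ⟩ 1 []
  e-store : ∀ {κ ρ α τ a x y} →
            Exec O w {κ = κ} (store a x y) ⟨ ρ , α , τ ⟩
              ⟨ ρ , α [ a ≔ write (α a) (ρ x) (ρ y) ] , τ ⟩ 1 []
  e-read  : ∀ {κ ρ α τ x y} →
            Exec O w {κ = κ} (read x y) ⟨ ρ , α , τ ⟩ ⟨ ρ [ x ≔ letter w (ρ y) ] , α , τ ⟩ 1 []
  e-len   : ∀ {κ ρ α τ x} →
            Exec O w {κ = κ} (inputLength x) ⟨ ρ , α , τ ⟩ ⟨ ρ [ x ≔ length w ] , α , τ ⟩ 1 []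
  e-seq   : ∀ {κ} {c d : Cmd r m κ} {s₁ s₂ s₃ t u ps qs} →
            Exec O w c s₁ s₂ t ps → Exec O w d s₂ s₃ u qs →
            Exec O w (c ⨾ d) s₁ s₃ (t + u) (ps ++ qs)
  e-if    : ∀ {κ} {c d : Cmd r m κ} {x ρ α τ s t qs} →
            Exec O w (if nonZero (ρ x) then c else d) ⟨ ρ , α , τ ⟩ s t qs →
            Exec O w (ifNZ x c d) ⟨ ρ , α , τ ⟩ s (suc t) qs
  e-while : ∀ {κ} {c : Cmd r m κ} {x ρ α τ s t qs} →
            Exec O w (if nonZero (ρ x) then c ⨾ whileNZ x c else skip) ⟨ ρ , α , τ ⟩ s t qs →
            Exec O w (whileNZ x c) ⟨ ρ , α , τ ⟩ s (suc t) qs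
  e-emit  : ∀ {ρ α τ x} →
            Exec O w (emit x) ⟨ ρ , α , τ ⟩ ⟨ ρ , α , τ ∷ʳ nonZero (ρ x) ⟩ 1 []
  e-query : ∀ {ρ α τ x b} → Reflects (O τ) b →
            Exec O w (query x) ⟨ ρ , α , τ ⟩
              ⟨ ρ [ x ≔ (if b then 1 else 0) ] , α , [] ⟩ 1 (τ ∷ [])

record Program (κ : Mode) : Set where
  field
    {nRegs nArrays} : ℕ
    body            : Cmd (suc nRegs) nArrays κ

initial : ∀ {r m} → Config r m
initial = ⟨ const 0 , (λ _ _ → 0) , [] ⟩

record Run {κ : Mode} (P : Program κ) (O : Language) (w : Word) : Set where
  open Program P
  field
    {final}   : Config (suc nRegs) nArrays
    {time}    : ℕ
    {queries} : List Word
    exec      : Exec O w body initial final time queries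

  Accepting : Set
  Accepting = Config.regs final zero ≢ 0

open Run public using (time; queries; Accepting)

-- Plain programs have no query command, so their oracle is irrelevant.
noOracle : Language
noOracle _ = ⊥

-- For 0 ≤ e = p/q this is ⌈ x^e ⌉, the number of naturals r with r^q < x^p.
-- Rounding up costs at most a factor 2 when x ≥ 1 and is exact when
-- x = 0 < e, so it is absorbed by the constants of all bounds below.
⌈_^_⌉ : ℕ → ℚ → ℕ
⌈ x ^ e ⌉ = length (filter (λ r → r ^ ↧ₙ e <? y) (upTo y))
  where y = x ^ abs (↥ e)

-- A saving ε in an exponent 1 - ε.  A positive saving can always be replaced
-- by a smaller positive one, so rationals below 1 suffice.
IsSaving : ℚ → Set
IsSaving ε = 0ℚ <ℚ ε × ε <ℚ 1ℚ

record ParameterizedProblem : Set₁ where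
  field
    language         : Language
    bestTime         : ℕ → ℕ
    arity            : ℕ
    param            : Fin arity → Word → ℕ
    param-computable : ∀ i → ComputableOnWords (param i)

  params : Word → Vec ℕ arity
  params w = Vec.tabulate (λ i → param i w)

  -- bestTime^{1-ε} at the length of w
  saved : ℚ → Word → ℕ
  saved ε w = ⌈ bestTime (length w) ^ 1ℚ -ℚ ε ⌉

open ParameterizedProblem public

restrict : ∀ {n} (K : Subset n) → Vec ℕ n → Vec ℕ ∣ K ∣
restrict []            []       = []
restrict (inside  ∷ K) (x ∷ xs) = x ∷ restrict K xs
restrict (outside ∷ K) (x ∷ xs) = restrict K xs

record FPI (A : ParameterizedProblem) (K : Subset (arity A)) : Set where
  field
    program      : Program plain
    run          : ∀ w → Run program noOracle w
    correct      : ∀ w → Accepting (run w) ⇔ language A w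
    ε            : ℚ
    saving       : IsSaving ε
    f            : Vec ℕ ∣ K ∣ → ℕ
    f-computable : Computable f
    efficient    : ∃[ C ] ∃[ n₀ ] ∀ w → n₀ ≤ length w →
                   time (run w) ≤ C * (saved A ε w * f (restrict K (params A w)))

infix 4 _≤PFG_

record _≤PFG_ (A B : ParameterizedProblem) : Set where
  field
    program      : Program oracle
    run          : ∀ w → Run program (language B) w
    correct      : ∀ w → Accepting (run w) ⇔ language A w
    efficient    : ∀ ε → IsSaving ε → ∃[ δ ] IsSaving δ × (∃[ c ] ∃[ n₀ ] ∀ w → n₀ ≤ length w →
                   time (run w) ≤ c * saved A δ w ×
                   sum (List.map (saved B ε) (queries (run w))) ≤ c * saved A δ w)
    g            : ℕ → Fin (arity B) → Vec ℕ (arity A) → ℕ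
    g-computable : ∀ j i → Computable (g j i)
    g-bounds     : ∀ w (j : Fin (length (queries (run w)))) i →
                   param B i (List.lookup (queries (run w)) j) ≤ g (toℕ j) i (params A w)

module _ {A B : ParameterizedProblem} (red : A ≤PFG B) where
  open _≤PFG_ red

  -- The number of queries depends on the instance, so j ranges over the
  -- queries made on the instance whose parameters are considered.
  Suffices : Subset (arity B) → Subset (arity A) → Set
  Suffices Λ K =
    Σ[ h ∈ (Vec ℕ ∣ K ∣ → ℕ) ] Computable h ×
      (∀ w (j : Fin (length (queries (run w)))) i → i ∈ Λ →
        g (toℕ j) i (params A w) ≤ h (restrict K (params A w)))

  IsMinimumNecessary : Subset (arity B) → Subset (arity A) → Set
  IsMinimumNecessary Λ K = Suffices Λ K × (∀ K′ → Suffices Λ K′ → ∣ K ∣ ≤ ∣ K′ ∣)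

{-# OPTIONS --safe #-}

-- Run the reduction and answer each query by running the algorithm for B on it.
-- A query costs O(b^{1-ε}(n_j) f(Λ-parameters)); these parameters are all at most
-- H = h(K-parameters of the input), so f can be replaced by F(H), where F(H) is
-- a sum of f over the box [0,H]^Λ, and the query costs sum to
-- O(a^{1-δ}(n) F(H)).  Queries too short for the asymptotic bound cost O(1) each,
-- and there are at most as many as the reduction has steps.
module Submission where

open import Data.Fin.Subset using (Subset)
open import Defs
open import Data.Bool using (Bool; true; false; if_then_else_)
open import Data.Fin using (Fin; zero; suc; _↑ˡ_; _↑ʳ_; splitAt)
import Data.Fin.Properties as Fin
open import Data.Fin.Subset using (inside; outside; _∈_; ∣_∣)
open import Data.List as List using (List; []; _∷_; _++_; _∷ʳ_; length)
open import Data.List.Properties using (length-++; map-++)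
open import Data.Nat hiding (nonZero)
open import Data.Nat.ListAction using (sum)
open import Data.Nat.ListAction.Properties using (sum-++)
open import Data.Nat.Properties
open import Data.Nat.Tactic.RingSolver using (solve-∀)
open import Data.Product using (Σ-syntax; ∃-syntax; _×_; _,_)
open import Data.Sum using (inj₁; inj₂; [_,_]′)
open import Data.Vec as Vec using (Vec; []; _∷_; tabulate; lookup)
open import Data.Vec.Properties using (lookup∘tabulate)
open import Data.Vec.Functional using (Vector)
open import Data.Vec.Functional.Properties using (updateAt-updates; updateAt-minimal)
open import Data.Vec.Relation.Binary.Pointwise.Inductive using (Pointwise; []; _∷_)
open import Data.Vec.Relation.Unary.All using (All; []; _∷_)
open import Function using (_∘_; const; _⇔_; mk⇔; Equivalence)
open import Function.Definitions using (Injective)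
open import Relation.Binary.PropositionalEquality hiding ([_])
open import Relation.Nullary using (yes; no; contradiction; Reflects; ofʸ; ofⁿ)
open import Relation.Nullary.Decidable using (dec-true; dec-false)
open Config

-- The reduction may submit up to as many queries as it takes steps, so besides the simulated run
-- each query may cost only a constant. Yet the algorithm for B expects all its registers and
-- unbounded arrays to be zero at every start, and one fixed machine has to serve all queries. Its
-- registers are finitely many and can be cleared one by one; its arrays are reset by a version
-- counter. The oracle tape becomes an array of the host, which the inlined algorithm reads as its
-- input. On the parameter side, `f` need not be monotone, so bounding its arguments does not bound
-- its value. A sum of naturals dominates each of its terms, and primitive recursion with addition
-- keeps it computable.

-- Computable majorants of recursive functions

plus : Rec 2
plus = prec (proj zero) (comp sucᶠ (proj (suc zero) ∷ []))

plus-correct : ∀ x y → plus [ x ∷ y ∷ [] ]⇓ x + y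
plus-correct zero    y = ⇓prec-zero ⇓proj
plus-correct (suc x) y = ⇓prec-suc (plus-correct x y) (⇓comp (⇓proj ∷ []) ⇓suc)

-- The renaming `σ` is arbitrary so that the induction can shift it by `suc`; `ys` is tied to it
-- only pointwise, so every use closes the hypothesis by `refl`.
projections-correct : ∀ {m n} (σ : Fin n → Fin m) {xs ys} →
                      (∀ i → lookup xs (σ i) ≡ lookup ys i) →
                      Pointwise (λ g y → g [ xs ]⇓ y) (tabulate (proj ∘ σ)) ys
projections-correct {n = zero}  σ {ys = []}     _  = []
projections-correct {n = suc n} σ {ys = y ∷ ys} eq =
  subst (_ [ _ ]⇓_) (eq zero) ⇓proj ∷ projections-correct (σ ∘ suc) (eq ∘ suc)

-- The summation index comes first because `prec` recurses on its first argument; it is spliced into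
-- the second place of `f`, behind the bound `b`, which stays fixed.
sumBelow : ∀ {n} → (Vec ℕ (2 + n) → ℕ) → ℕ → Vec ℕ (1 + n) → ℕ
sumBelow f zero    bs       = 0
sumBelow f (suc k) (b ∷ xs) = sumBelow f k (b ∷ xs) + f (b ∷ k ∷ xs)

module _ {n} {f : Vec ℕ (2 + n) → ℕ} where

  sumBelow-computable : (p : Computable f) →
    Σ[ q ∈ Rec (2 + n) ] (∀ k bs → q [ k ∷ bs ]⇓ sumBelow f k bs)
  sumBelow-computable (p , p-correct) = prec zeroᶠ next , correct
    where
    next : Rec (3 + n)
    -- `prec` passes the index, the partial sum, then `b` and `xs`; for `p` the order of index and
    -- `b` is exchanged.
    next = comp plus (proj (suc zero) ∷
      comp p (proj (suc (suc zero)) ∷ proj zero ∷ tabulate (λ i → proj (suc (suc (suc i))))) ∷ [])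

    correct : ∀ k bs → prec zeroᶠ next [ k ∷ bs ]⇓ sumBelow f k bs
    correct zero    bs       = ⇓prec-zero ⇓zero
    correct (suc k) (b ∷ xs) = ⇓prec-suc (correct k (b ∷ xs))
      (⇓comp (⇓proj ∷ ⇓comp (⇓proj ∷ ⇓proj ∷ projections-correct _ (λ _ → refl)) (p-correct _) ∷ [])
        (plus-correct _ _))

  term≤sumBelow : ∀ {x k} b xs → x < k → f (b ∷ x ∷ xs) ≤ sumBelow f k (b ∷ xs)
  term≤sumBelow {x} {suc k} b xs x<1+k with m≤n⇒m<n∨m≡n (s≤s⁻¹ x<1+k)
  ... | inj₁ x<k  = ≤-trans (term≤sumBelow b xs x<k) (m≤m+n _ _)
  ... | inj₂ refl = m≤n+m _ _

-- The first argument of f carries the bound, so that summing out the second one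
-- leaves a function of the same shape.
AnchoredMajorant : ∀ {n} → (Vec ℕ (suc n) → ℕ) → Set
AnchoredMajorant f = Σ[ F ∈ (Vec ℕ 1 → ℕ) ] Computable F ×
  (∀ b xs → All (_≤ b) xs → f (b ∷ xs) ≤ F (b ∷ []))

-- Induction on the number of coordinates behind the anchor: each is eliminated by summing over all
-- its values up to the anchor, and the others keep their bound.
anchored-majorant : ∀ {n} (f : Vec ℕ (suc n) → ℕ) → Computable f → AnchoredMajorant f
anchored-majorant {zero}  f f-comp = f , f-comp , λ { b [] [] → ≤-refl }
anchored-majorant {suc n} f f-comp =
  let q , q-correct = sumBelow-computable f-comp
      -- The upper end is one more than the anchor: `sumBelow` excludes its end, while a coordinate
      -- may equal the anchor.
      F , F-comp , f′≤F = anchored-majorant (λ bs → sumBelow f (suc (Vec.head bs)) bs)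
        ( comp q (comp sucᶠ (proj zero ∷ []) ∷ proj zero ∷ tabulate (λ i → proj (suc i)))
        , λ { (b ∷ xs) → ⇓comp (⇓comp (⇓proj ∷ []) ⇓suc ∷ ⇓proj ∷ projections-correct suc (λ _ → refl))
                               (q-correct _ _) })
  in F , F-comp , λ { b (x ∷ xs) (x≤b ∷ xs≤b) →
       ≤-trans (term≤sumBelow b xs (s≤s x≤b)) (f′≤F b xs xs≤b) }

-- An anchor that `f` ignores is put in front of its arguments.
majorant : ∀ {n} (f : Vec ℕ n → ℕ) → Computable f →
  Σ[ F ∈ (Vec ℕ 1 → ℕ) ] Computable F × (∀ b xs → All (_≤ b) xs → f xs ≤ F (b ∷ []))
majorant f (p , p-correct) = anchored-majorant (λ bs → f (Vec.tail bs))
  ( comp p (tabulate (proj ∘ suc))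
  , λ { (b ∷ xs) → ⇓comp (projections-correct suc (λ _ → refl)) (p-correct xs) })

-- Array writes, indexed updates and letters of a word

write-same : ∀ a {i j} v → j ≡ i → write a i v j ≡ v
write-same a {i} {j} v j≡i = cong (if_then v else a j) (dec-true (j ≟ i) j≡i)

write-other : ∀ a {i j} v → j ≢ i → write a i v j ≡ a j
write-other a {i} {j} v j≢i = cong (if_then v else a j) (dec-false (j ≟ i) j≢i)

write-cong : ∀ {a a′ : ℕ → ℕ} {i i′ v v′} → (∀ j → a j ≡ a′ j) → i ≡ i′ → v ≡ v′ →
             ∀ j → write a i v j ≡ write a′ i′ v′ j
write-cong {i = i} {v = v} a≡a′ refl refl j = cong (if _ then v else_) (a≡a′ j)

-- `P` is equality for registers and pointwise equality for arrays; injectivity of `e` ensures that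
-- an update at `e i` leaves every other image untouched.
update-cong : ∀ {A B : Set} {n m} (P : A → B → Set) {e : Fin n → Fin m} → Injective _≡_ _≡_ e →
              ∀ {xs : Vector A m} {ys : Vector B n} {x y} i → (∀ j → P (xs (e j)) (ys j)) → P x y →
              ∀ j → P ((xs [ e i ≔ x ]) (e j)) ((ys [ i ≔ y ]) j)
update-cong P {e} e-inj {xs} {ys} i Pxs Pxy j with j Fin.≟ i
... | yes refl = subst₂ P (sym (updateAt-updates (e j) xs)) (sym (updateAt-updates j ys)) Pxy
... | no j≢i   = subst₂ P (sym (updateAt-minimal (e j) (e i) xs (j≢i ∘ e-inj)))
                          (sym (updateAt-minimal j i ys j≢i)) (Pxs j)

-- The encoding used by `letter`, where 0 is reserved for positions past the end.
symbol : Bool → ℕ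
symbol b = if b then 2 else 1

letter-beyond : ∀ w {i} → length w ≤ i → letter w i ≡ 0
letter-beyond []          _         = refl
letter-beyond (false ∷ w) (s≤s w≤i) = letter-beyond w w≤i
letter-beyond (true  ∷ w) (s≤s w≤i) = letter-beyond w w≤i

letter-∷ʳ-init : ∀ w b {i} → i < length w → letter (w ∷ʳ b) i ≡ letter w i
letter-∷ʳ-init (false ∷ w) b {zero}  _         = refl
letter-∷ʳ-init (true  ∷ w) b {zero}  _         = refl
letter-∷ʳ-init (false ∷ w) b {suc i} (s≤s i<w) = letter-∷ʳ-init w b i<w
letter-∷ʳ-init (true  ∷ w) b {suc i} (s≤s i<w) = letter-∷ʳ-init w b i<w

letter-∷ʳ-last : ∀ w b → letter (w ∷ʳ b) (length w) ≡ symbol b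
letter-∷ʳ-last []          false = refl
letter-∷ʳ-last []          true  = refl
letter-∷ʳ-last (false ∷ w) b     = letter-∷ʳ-last w b
letter-∷ʳ-last (true  ∷ w) b     = letter-∷ʳ-last w b

length-∷ʳ : ∀ (w : Word) b → length (w ∷ʳ b) ≡ suc (length w)
length-∷ʳ w b = trans (length-++ w) (+-comm (length w) 1)

-- Memory layout and representation of both programs in one machine

data Register (a b : ℕ) : Set where
  outer : Fin a → Register a b
  inner : Fin b → Register a b
  version tapeLength scratch : Register a b

data Array (m n : ℕ) : Set where
  outer         : Fin m → Array m n
  content stamp : Fin n → Array m n
  tapeArray     : Array m n

-- An array of the inner program is meaningful only where its stamp equals the
-- current version, and is 0 elsewhere; incrementing the version therefore
-- resets all arrays in constant time.
module Simulation
  {a b m n N M : ℕ}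
  (reg : Register a (suc b) → Fin N) (reg-injective : Injective _≡_ _≡_ reg)
  (arr : Array m n → Fin M) (arr-injective : Injective _≡_ _≡_ arr)
  where

  outer-injective : Injective _≡_ _≡_ (reg ∘ outer)
  outer-injective eq with refl ← reg-injective eq = refl

  inner-injective : Injective _≡_ _≡_ (reg ∘ inner)
  inner-injective eq with refl ← reg-injective eq = refl

  outerArray-injective : Injective _≡_ _≡_ (arr ∘ outer)
  outerArray-injective eq with refl ← arr-injective eq = refl

  Target : Set
  Target = Cmd N M plain

  State : Set
  State = Config N M

  assign-same : ∀ {R : Vector ℕ N} x {v} → (R [ reg x ≔ v ]) (reg x) ≡ v
  assign-same {R} x = updateAt-updates (reg x) R

  assign-other : ∀ {R : Vector ℕ N} x y {v} → x ≢ y → (R [ reg y ≔ v ]) (reg x) ≡ R (reg x)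
  assign-other {R} x y x≢y = updateAt-minimal (reg x) (reg y) R (x≢y ∘ reg-injective)

  store-same : ∀ {Z : Vector (ℕ → ℕ) M} x {f} k → (Z [ arr x ≔ f ]) (arr x) k ≡ f k
  store-same {Z} x k = cong-app (updateAt-updates (arr x) Z) k

  store-other : ∀ {Z : Vector (ℕ → ℕ) M} x y {f} k → x ≢ y → (Z [ arr y ≔ f ]) (arr x) k ≡ Z (arr x) k
  store-other {Z} x y k x≢y = cong-app (updateAt-minimal (arr x) (arr y) Z (x≢y ∘ arr-injective)) k

  -- `stamped≤current` makes any increased version differ from all existing stamps, so a later run
  -- cannot mistake an old entry for its own.
  record Cell (current stamped stored value : ℕ) : Set where
    constructor cell
    field
      stamped≤current : stamped ≤ current
      fresh           : stamped ≡ current → stored ≡ value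
      stale           : stamped ≢ current → value ≡ 0
  open Cell

  -- S represents the outer configuration s together with the registers ρ and
  -- arrays α of the inner program, whose input is the oracle tape of s.
  record Represents (s : Config a m) (ρ : Vector ℕ (suc b)) (α : Vector (ℕ → ℕ) n) (S : State) : Set where
    constructor represents
    field
      outer-regs   : ∀ i → regs S (reg (outer i)) ≡ regs s i
      inner-regs   : ∀ i → regs S (reg (inner i)) ≡ ρ i
      outer-arrays : ∀ i k → arrays S (arr (outer i)) k ≡ arrays s i k
      inner-arrays : ∀ i k → Cell (regs S (reg version)) (arrays S (arr (stamp i)) k)
                                  (arrays S (arr (content i)) k) (α i k)
      tape-length  : regs S (reg tapeLength) ≡ length (tape s)
      tape-content : ∀ {i} → i < length (tape s) → arrays S (arr tapeArray) i ≡ letter (tape s) i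
  open Represents

  private
   variable
    r : Vector ℕ a
    ρ : Vector ℕ (suc b)
    z : Vector (ℕ → ℕ) m
    α : Vector (ℕ → ℕ) n
    t : Word
    s : Config a m
    S : State

  set-scratch : ∀ {v} → Represents s ρ α S →
    Represents s ρ α ⟨ regs S [ reg scratch ≔ v ] , arrays S , tape S ⟩
  set-scratch rep = represents
    (λ i → trans (assign-other (outer i) scratch λ ()) (outer-regs rep i))
    (λ i → trans (assign-other (inner i) scratch λ ()) (inner-regs rep i))
    (outer-arrays rep)
    (λ i k → subst (λ v → Cell v _ _ _) (sym (assign-other version scratch λ ())) (inner-arrays rep i k))
    (trans (assign-other tapeLength scratch λ ()) (tape-length rep))
    (tape-content rep)

  set-outer : ∀ {v v′} x → v ≡ v′ → Represents ⟨ r , z , t ⟩ ρ α S →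
    Represents ⟨ r [ x ≔ v′ ] , z , t ⟩ ρ α ⟨ regs S [ reg (outer x) ≔ v ] , arrays S , tape S ⟩
  set-outer x eq rep = represents
    (update-cong _≡_ outer-injective x (outer-regs rep) eq)
    (λ i → trans (assign-other (inner i) (outer x) λ ()) (inner-regs rep i))
    (outer-arrays rep)
    (λ i k → subst (λ v → Cell v _ _ _) (sym (assign-other version (outer x) λ ())) (inner-arrays rep i k))
    (trans (assign-other tapeLength (outer x) λ ()) (tape-length rep))
    (tape-content rep)

  set-inner : ∀ {v v′} x → v ≡ v′ → Represents s ρ α S →
    Represents s (ρ [ x ≔ v′ ]) α ⟨ regs S [ reg (inner x) ≔ v ] , arrays S , tape S ⟩
  set-inner x eq rep = represents
    (λ i → trans (assign-other (outer i) (inner x) λ ()) (outer-regs rep i))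
    (update-cong _≡_ inner-injective x (inner-regs rep) eq)
    (outer-arrays rep)
    (λ i k → subst (λ v → Cell v _ _ _) (sym (assign-other version (inner x) λ ())) (inner-arrays rep i k))
    (trans (assign-other tapeLength (inner x) λ ()) (tape-length rep))
    (tape-content rep)

  store-outer : ∀ {i i′ v v′} x → i ≡ i′ → v ≡ v′ → Represents ⟨ r , z , t ⟩ ρ α S →
    Represents ⟨ r , z [ x ≔ write (z x) i′ v′ ] , t ⟩ ρ α
      ⟨ regs S , arrays S [ arr (outer x) ≔ write (arrays S (arr (outer x))) i v ] , tape S ⟩
  store-outer {z = z} {S = S} x i≡ v≡ rep = represents
    (outer-regs rep)
    (inner-regs rep)
    (update-cong (λ f g → ∀ k → f k ≡ g k) outerArray-injective {arrays S} {z} x (outer-arrays rep)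
      (write-cong (outer-arrays rep x) i≡ v≡))
    (λ i k → subst₂ (λ p q → Cell _ p q _)
      (sym (store-other (stamp i) (outer x) k λ ())) (sym (store-other (content i) (outer x) k λ ()))
      (inner-arrays rep i k))
    (tape-length rep)
    (λ {i} i<t → trans (store-other tapeArray (outer x) i λ ()) (tape-content rep i<t))

  -- The written position is stamped with the current version, so `stale` is vacuous there; the
  -- other positions keep their cells.
  write-cell : ∀ {i i′ v v′ c} {p q f : ℕ → ℕ} → i ≡ i′ → v ≡ v′ → (∀ k → Cell c (p k) (q k) (f k)) →
               ∀ k → Cell c (write p i c k) (write q i v k) (write f i′ v′ k)
  write-cell {i} {v = v} {c = c} {p} {q} {f} refl refl cells k with k ≟ i
  ... | yes k≡i = subst₂ (λ x y → Cell c x y (write f i v k))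
    (sym (write-same p c k≡i)) (sym (write-same q v k≡i))
    (cell ≤-refl (λ _ → sym (write-same f v k≡i)) (contradiction refl))
  ... | no k≢i = subst₂ (λ x y → Cell c x y (write f i v k))
    (sym (write-other p c k≢i)) (sym (write-other q v k≢i))
    (subst (Cell c (p k) (q k)) (sym (write-other f v k≢i)) (cells k))

  store-inner : ∀ {i i′ v v′} x → i ≡ i′ → v ≡ v′ → Represents s ρ α S →
    let Z = arrays S [ arr (content x) ≔ write (arrays S (arr (content x))) i v ] in
    Represents s ρ (α [ x ≔ write (α x) i′ v′ ])
      ⟨ regs S , Z [ arr (stamp x) ≔ write (Z (arr (stamp x))) i (regs S (reg version)) ] , tape S ⟩
  store-inner {α = α} {S = S} {i} {i′} {v} {v′} x i≡ v≡ rep = represents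
    (outer-regs rep)
    (inner-regs rep)
    (λ i k → trans (store-other (outer i) (stamp x) k λ ())
               (trans (store-other (outer i) (content x) k λ ()) (outer-arrays rep i k)))
    cells
    (tape-length rep)
    (λ {i} i<t → trans (store-other tapeArray (stamp x) i λ ())
                   (trans (store-other tapeArray (content x) i λ ()) (tape-content rep i<t)))
    where
    c  = regs S (reg version)
    Z  = arrays S [ arr (content x) ≔ write (arrays S (arr (content x))) i v ]
    Z′ = Z [ arr (stamp x) ≔ write (Z (arr (stamp x))) i c ]

    cells : ∀ j k → Cell c (Z′ (arr (stamp j)) k) (Z′ (arr (content j)) k) ((α [ x ≔ write (α x) i′ v′ ]) j k)
    cells j k with j Fin.≟ x
    ... | yes refl
      rewrite updateAt-updates x {const (write (α x) i′ v′)} α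
            | updateAt-updates (arr (stamp x)) {const (write (Z (arr (stamp x))) i c)} Z
            | updateAt-minimal (arr (content x)) (arr (stamp x))
                {const (write (Z (arr (stamp x))) i c)} Z ((λ ()) ∘ arr-injective)
            | updateAt-updates (arr (content x)) {const (write (arrays S (arr (content x))) i v)} (arrays S)
            | updateAt-minimal (arr (stamp x)) (arr (content x))
                {const (write (arrays S (arr (content x))) i v)} (arrays S) ((λ ()) ∘ arr-injective)
      = write-cell i≡ v≡ (inner-arrays rep x) k
    ... | no j≢x = subst₂ (λ p q → Cell c p q _)
      (sym (trans (store-other (stamp j) (stamp x) k λ { refl → j≢x refl })
                  (store-other (stamp j) (content x) k λ ())))
      (sym (trans (store-other (content j) (stamp x) k λ ())
                  (store-other (content j) (content x) k λ { refl → j≢x refl })))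
      (subst (Cell c _ _) (sym (cong-app (updateAt-minimal j x α j≢x) k)) (inner-arrays rep j k))

  reset-arrays : ∀ {v} → regs S (reg version) < v → Represents s ρ α S →
    Represents s ρ (λ _ _ → 0) ⟨ regs S [ reg version ≔ v ] , arrays S , tape S ⟩
  reset-arrays {v = v} V<v rep = represents
    (λ i → trans (assign-other (outer i) version λ ()) (outer-regs rep i))
    (λ i → trans (assign-other (inner i) version λ ()) (inner-regs rep i))
    (outer-arrays rep)
    (λ i k → subst (λ c → Cell c _ _ _) (sym (assign-same version))
      (let old<v = ≤-<-trans (stamped≤current (inner-arrays rep i k)) V<v in
       cell (<⇒≤ old<v) (λ eq → contradiction eq (<⇒≢ old<v)) (λ _ → refl)))
    (trans (assign-other tapeLength version λ ()) (tape-length rep))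
    (tape-content rep)

  -- Setting the length to 0 suffices, because `tape-content` constrains only positions below it;
  -- the old letters stay in the array.
  erase-tape : Represents ⟨ r , z , t ⟩ ρ α S →
    Represents ⟨ r , z , [] ⟩ ρ α ⟨ regs S [ reg tapeLength ≔ 0 ] , arrays S , tape S ⟩
  erase-tape rep = represents
    (λ i → trans (assign-other (outer i) tapeLength λ ()) (outer-regs rep i))
    (λ i → trans (assign-other (inner i) tapeLength λ ()) (inner-regs rep i))
    (outer-arrays rep)
    (λ i k → subst (λ v → Cell v _ _ _) (sym (assign-other version tapeLength λ ())) (inner-arrays rep i k))
    (assign-same tapeLength)
    (λ ())

  extend-tape : ∀ {i v ℓ} β → i ≡ length t → v ≡ symbol β → ℓ ≡ suc (length t) →
    Represents ⟨ r , z , t ⟩ ρ α S →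
    Represents ⟨ r , z , t ∷ʳ β ⟩ ρ α
      ⟨ regs S [ reg tapeLength ≔ ℓ ] , arrays S [ arr tapeArray ≔ write (arrays S (arr tapeArray)) i v ] , tape S ⟩
  extend-tape {t = t} {S = S} {v = v} β refl refl refl rep = represents
    (λ i → trans (assign-other (outer i) tapeLength λ ()) (outer-regs rep i))
    (λ i → trans (assign-other (inner i) tapeLength λ ()) (inner-regs rep i))
    (λ i k → trans (store-other (outer i) tapeArray k λ ()) (outer-arrays rep i k))
    (λ i k → subst₂ (λ p q → Cell _ p q _)
      (sym (store-other (stamp i) tapeArray k λ ())) (sym (store-other (content i) tapeArray k λ ()))
      (subst (λ v → Cell v _ _ _) (sym (assign-other version tapeLength λ ())) (inner-arrays rep i k)))
    (trans (assign-same tapeLength) (sym (length-∷ʳ t β)))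
    (λ {i} i<tβ → trans (store-same tapeArray i) (contents (subst (i <_) (length-∷ʳ t β) i<tβ)))
    where
    contents : ∀ {i} → i < suc (length t) →
               write (arrays S (arr tapeArray)) (length t) v i ≡ letter (t ∷ʳ β) i
    contents {i} i≤t with m≤n⇒m<n∨m≡n (s≤s⁻¹ i≤t)
    ... | inj₁ i<t  = trans (write-other (arrays S (arr tapeArray)) _ (<⇒≢ i<t))
                        (trans (tape-content rep i<t) (sym (letter-∷ʳ-init t β i<t)))
    ... | inj₂ refl = trans (write-same (arrays S (arr tapeArray)) {length t} _ refl) (sym (letter-∷ʳ-last t β))

  -- Executions with a postcondition and a time bound

  record Reaches (w : Word) (C : Target) (S : State) (Φ : State → Set) (bound : ℕ) : Set where
    constructor reaches
    field
      {final} : State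
      {steps} : ℕ
      {asked} : List Word
      exec    : Exec noOracle w C S final steps asked
      post    : Φ final
      within  : steps ≤ bound

  private
   variable
    w : Word
    C D : Target
    Φ Ψ : State → Set
    i j k : ℕ

  done : ∀ {S′ T qs} → Exec noOracle w C S S′ T qs → Φ S′ → Reaches w C S Φ T
  done exec post = reaches exec post ≤-refl

  relax : i ≤ j → Reaches w C S Φ i → Reaches w C S Φ j
  relax i≤j (reaches e p T≤i) = reaches e p (≤-trans T≤i i≤j)

  infixr 5 _then_
  _then_ : Reaches w C S Φ i → (∀ {S′} → Φ S′ → Reaches w D S′ Ψ j) → Reaches w (C ⨾ D) S Ψ (i + j)
  reaches e p T≤ then next with reaches e′ p′ T′≤ ← next p = reaches (e-seq e e′) p′ (+-mono-≤ T≤ T′≤)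

  -- The tested value `v` is kept apart from the register holding it, so that the choice can be
  -- expressed by the value in the source program.
  branch : ∀ {x v} → regs S x ≡ v →
    Reaches w (if nonZero v then C else D) S Φ k → Reaches w (ifNZ x C D) S Φ (suc k)
  branch refl (reaches e p T≤) = reaches (e-if e) p (s≤s T≤)

  loop : ∀ {x v} → regs S x ≡ v →
    Reaches w (if nonZero v then C ⨾ whileNZ x C else skip) S Φ k → Reaches w (whileNZ x C) S Φ (suc k)
  loop refl (reaches e p T≤) = reaches (e-while e) p (s≤s T≤)

  -- Inlining the algorithm for B on the stored oracle tape

  -- Truncated subtraction serves as comparison. Version minus stamp is 0 exactly for fresh cells,
  -- as stamps never exceed the version; tape length minus position is nonzero exactly inside the
  -- tape.
  inline : Cmd (suc b) n plain → Target
  inline skip            = skip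
  inline (set x v)       = set (reg (inner x)) v
  inline (add x y z)     = add (reg (inner x)) (reg (inner y)) (reg (inner z))
  inline (sub x y z)     = sub (reg (inner x)) (reg (inner y)) (reg (inner z))
  inline (half x y)      = half (reg (inner x)) (reg (inner y))
  inline (load x i y)    =
    (load (reg scratch) (arr (stamp i)) (reg (inner y)) ⨾
     sub (reg scratch) (reg version) (reg scratch)) ⨾
    ifNZ (reg scratch) (set (reg (inner x)) 0) (load (reg (inner x)) (arr (content i)) (reg (inner y)))
  inline (store i x y)   =
    store (arr (content i)) (reg (inner x)) (reg (inner y)) ⨾
    store (arr (stamp i)) (reg (inner x)) (reg version)
  inline (read x y)      =
    sub (reg scratch) (reg tapeLength) (reg (inner y)) ⨾
    ifNZ (reg scratch) (load (reg (inner x)) (arr tapeArray) (reg (inner y))) (set (reg (inner x)) 0)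
  inline (inputLength x) =
    set (reg scratch) 0 ⨾
    add (reg (inner x)) (reg tapeLength) (reg scratch)
  inline (c ⨾ d)         = inline c ⨾ inline d
  inline (ifNZ x c d)    = ifNZ (reg (inner x)) (inline c) (inline d)
  inline (whileNZ x c)   = whileNZ (reg (inner x)) (inline c)

  inline-if : ∀ β {c d} → inline (if β then c else d) ≡ (if β then inline c else inline d)
  inline-if false = refl
  inline-if true  = refl

  fetch : Represents s ρ α S → ∀ x i y v →
    v ≡ regs S (reg version) ∸ arrays S (arr (stamp i)) (regs S (reg (inner y))) →
    Reaches w (if nonZero v then set (reg (inner x)) 0
                            else load (reg (inner x)) (arr (content i)) (reg (inner y)))
            S (Represents s (ρ [ x ≔ α i (ρ y) ]) α) 1
  fetch {α = α} rep x i y zero eq = done e-load (set-inner x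
    (trans (fresh current (≤-antisym (stamped≤current current) (m∸n≡0⇒m≤n (sym eq))))
           (cong (α i) (inner-regs rep y)))
    rep)
    where current = inner-arrays rep i _
  fetch {α = α} {S = S} rep x i y (suc _) eq = done e-set (set-inner x
    (sym (trans (cong (α i) (sym (inner-regs rep y)))
                (stale (inner-arrays rep i _) outdated)))
    rep)
    where
    outdated : arrays S (arr (stamp i)) (regs S (reg (inner y))) ≢ regs S (reg version)
    outdated same with () ← trans eq (m≤n⇒m∸n≡0 (≤-reflexive (sym same)))

  scan : Represents s ρ α S → ∀ x y v →
    v ≡ regs S (reg tapeLength) ∸ regs S (reg (inner y)) →
    Reaches w (if nonZero v then load (reg (inner x)) (arr tapeArray) (reg (inner y))
                            else set (reg (inner x)) 0)
            S (Represents s (ρ [ x ≔ letter (tape s) (ρ y) ]) α) 1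
  scan {s = s} rep x y zero eq = done e-set (set-inner x
    (sym (letter-beyond (tape s)
      (subst₂ _≤_ (tape-length rep) (inner-regs rep y) (m∸n≡0⇒m≤n (sym eq)))))
    rep)
  scan {s = s} {S = S} rep x y (suc _) eq = done e-load (set-inner x
    (trans (tape-content rep (subst (_ <_) (tape-length rep) (≰⇒> exhausted)))
           (cong (letter (tape s)) (inner-regs rep y)))
    rep)
    where
    exhausted : regs S (reg tapeLength) ≰ regs S (reg (inner y))
    exhausted ≤y with () ← trans eq (m≤n⇒m∸n≡0 ≤y)

  4*-suc : ∀ t → suc (4 * t) ≤ 4 * suc t
  4*-suc t = subst (suc (4 * t) ≤_) (sym (*-suc 4 t)) (s≤s (m≤n+m (4 * t) 3))

  -- The factor 4 comes from `load`, the costliest translation: fetch the stamp, subtract, test,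
  -- assign. The inner input is `tape s`, held in `tapeArray`, so the input `w` of the host is
  -- arbitrary.
  inline-correct : ∀ {O : Language} {c : Cmd (suc b) n plain} {q q′ : Config (suc b) n} {T qs} →
    Exec O (tape s) c q q′ T qs → Represents s (regs q) (arrays q) S →
    Reaches w (inline c) S (Represents s (regs q′) (arrays q′)) (4 * T)
  inline-correct e-skip rep = done e-skip rep
  inline-correct e-set rep = relax (s≤s z≤n) (done e-set (set-inner _ refl rep))
  inline-correct (e-add {y = y} {z}) rep = relax (s≤s z≤n)
    (done e-add (set-inner _ (cong₂ _+_ (inner-regs rep y) (inner-regs rep z)) rep))
  inline-correct (e-sub {y = y} {z}) rep = relax (s≤s z≤n)
    (done e-sub (set-inner _ (cong₂ _∸_ (inner-regs rep y) (inner-regs rep z)) rep))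
  inline-correct (e-half {y = y}) rep = relax (s≤s z≤n)
    (done e-half (set-inner _ (cong ⌊_/2⌋ (inner-regs rep y)) rep))
  inline-correct {s = s} {S} (e-load {ρ = ρ} {α} {x = x} {i} {y}) rep =
    done {Φ = λ S′ → Represents s ρ α S′ ×
            regs S′ (reg scratch) ≡ regs S′ (reg version) ∸ arrays S′ (arr (stamp i)) (regs S′ (reg (inner y)))}
      (e-seq e-load e-sub)
      ( set-scratch (set-scratch rep)
      , trans (assign-same scratch)
          (trans (cong₂ _∸_ (assign-other version scratch λ ()) (assign-same scratch))
            (sym (cong₂ (λ v k → v ∸ arrays S (arr (stamp i)) k)
              (trans (assign-other version scratch λ ()) (assign-other version scratch λ ()))
              (trans (assign-other (inner y) scratch λ ()) (assign-other (inner y) scratch λ ()))))))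
    then λ { (rep′ , eq) → branch refl (fetch rep′ x i y _ eq) }
  inline-correct (e-store {a = i} {x} {y}) rep = relax (s≤s (s≤s z≤n))
    (done (e-seq e-store e-store) (store-inner i (inner-regs rep x) (inner-regs rep y) rep))
  inline-correct {s = s} (e-read {ρ = ρ} {α} {x = x} {y}) rep = relax (s≤s (s≤s (s≤s z≤n))) (
    done {Φ = λ S′ → Represents s ρ α S′ ×
            regs S′ (reg scratch) ≡ regs S′ (reg tapeLength) ∸ regs S′ (reg (inner y))}
      e-sub
      ( set-scratch rep
      , trans (assign-same scratch)
          (sym (cong₂ _∸_ (assign-other tapeLength scratch λ ()) (assign-other (inner y) scratch λ ()))))
    then λ { (rep′ , eq) → branch refl (scan rep′ x y _ eq) })
  inline-correct {s = s} (e-len {x = x}) rep = relax (s≤s (s≤s z≤n))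
    (done (e-seq e-set e-add) (set-inner x
      (trans (cong₂ _+_ (trans (assign-other tapeLength scratch λ ()) (tape-length rep)) (assign-same scratch))
             (+-identityʳ _))
      (set-scratch rep)))
  inline-correct (e-seq {t = t} {u} e e′) rep =
    relax (≤-reflexive (sym (*-distribˡ-+ 4 t u)))
      (inline-correct e rep then inline-correct e′)
  inline-correct (e-if {x = x} {ρ = ρ} {t = t} e) rep =
    relax (4*-suc t)
      (branch (inner-regs rep x)
        (subst (λ C → Reaches _ C _ _ _) (inline-if (nonZero (ρ x))) (inline-correct e rep)))
  inline-correct (e-while {x = x} {ρ = ρ} {t = t} e) rep =
    relax (4*-suc t)
      (loop (inner-regs rep x)
        (subst (λ C → Reaches _ C _ _ _) (inline-if (nonZero (ρ x))) (inline-correct e rep)))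

  clear : ∀ {k} → (Fin k → Fin (suc b)) → Target
  clear {zero}  e = skip
  clear {suc k} e = set (reg (inner (e zero))) 0 ⨾ clear (e ∘ suc)

  -- Preservation of zeros is part of the conclusion because the register cleared first must survive
  -- the remaining assignments.
  clear-correct : ∀ {k} (e : Fin k → Fin (suc b)) → Represents s ρ α S →
    Reaches w (clear e) S (λ S′ → ∃[ ρ′ ] Represents s ρ′ α S′ ×
      (∀ i → ρ′ (e i) ≡ 0) × (∀ i → ρ i ≡ 0 → ρ′ i ≡ 0)) k
  clear-correct {k = zero} e rep = done e-skip (_ , rep , (λ ()) , λ _ eq → eq)
  clear-correct {ρ = ρ} {k = suc k} e rep =
    done e-set (set-inner (e zero) refl rep) then λ rep′ →
      let reaches exec (ρ′ , rep″ , cleared , kept) within = clear-correct (e ∘ suc) rep′ in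
      reaches exec
        ( ρ′ , rep″
        , (λ { zero → kept (e zero) (updateAt-updates (e zero) ρ) ; (suc i) → cleared i })
        , λ i eq → kept i (still-zero i eq))
        within
    where
    still-zero : ∀ i → ρ i ≡ 0 → (ρ [ e zero ≔ 0 ]) i ≡ 0
    still-zero i eq with i Fin.≟ e zero
    ... | yes refl = updateAt-updates i ρ
    ... | no i≢    = trans (updateAt-minimal i (e zero) ρ i≢) eq

  asProgram : Cmd (suc b) n plain → Program plain
  asProgram c = record { body = c }

  -- Compiling the reduction with queries answered in place

  module Oracle
    (Q : Cmd (suc b) n plain)
    (L : Language) (runQ : ∀ v → Run (asProgram Q) noOracle v) (correctQ : ∀ v → Accepting (runQ v) ⇔ L v)
    where

    answer : Fin a → Target
    answer x =
      ((set (reg scratch) 1 ⨾ add (reg version) (reg version) (reg scratch)) ⨾ clear {suc b} (λ i → i)) ⨾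
      (inline Q ⨾
      (ifNZ (reg (inner zero)) (set (reg (outer x)) 1) (set (reg (outer x)) 0) ⨾
      set (reg tapeLength) 0))

    append : Fin a → Target
    append x =
      ifNZ (reg (outer x)) (set (reg scratch) 2) (set (reg scratch) 1) ⨾
      ((store (arr tapeArray) (reg tapeLength) (reg scratch) ⨾ set (reg scratch) 1) ⨾
      add (reg tapeLength) (reg tapeLength) (reg scratch))

    compile : ∀ {κ} → Cmd a m κ → Target
    compile skip            = skip
    compile (set x v)       = set (reg (outer x)) v
    compile (add x y z)     = add (reg (outer x)) (reg (outer y)) (reg (outer z))
    compile (sub x y z)     = sub (reg (outer x)) (reg (outer y)) (reg (outer z))
    compile (half x y)      = half (reg (outer x)) (reg (outer y))
    compile (load x i y)    = load (reg (outer x)) (arr (outer i)) (reg (outer y))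
    compile (store i x y)   = store (arr (outer i)) (reg (outer x)) (reg (outer y))
    compile (read x y)      = read (reg (outer x)) (reg (outer y))
    compile (inputLength x) = inputLength (reg (outer x))
    compile (c ⨾ d)         = compile c ⨾ compile d
    compile (ifNZ x c d)    = ifNZ (reg (outer x)) (compile c) (compile d)
    compile (whileNZ x c)   = whileNZ (reg (outer x)) (compile c)
    compile (emit x)        = append x
    compile (query x)       = answer x

    compile-if : ∀ β {κ} {c d : Cmd a m κ} → compile (if β then c else d) ≡ (if β then compile c else compile d)
    compile-if false = refl
    compile-if true  = refl

    -- The inner state is existential: `answer` resets it before each run, so whatever the previous
    -- run left behind is acceptable.
    Implements : Config a m → State → Set
    Implements s S = ∃[ ρ ] ∃[ α ] Represents s ρ α S

    -- The cost is 2 for raising the version, `suc b` for clearing registers, four times the inner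
    -- run, and 3 for testing and copying the verdict and erasing the tape. The copied bit is `β`
    -- because acceptance is equivalent to `L t`, which `β` reflects.
    answer-correct : ∀ {β} x → Reflects (L t) β → Represents ⟨ r , z , t ⟩ ρ α S →
      Reaches w (answer x) S (Implements ⟨ r [ x ≔ (if β then 1 else 0) ] , z , [] ⟩)
        ((2 + suc b) + (4 * time (runQ t) + 3))
    answer-correct {t = t} {r = r} {z = z} {S = S} {β = β} x L-β rep =
      ((done {Φ = Represents ⟨ r , z , t ⟩ _ (λ _ _ → 0)} (e-seq e-set e-add)
         (reset-arrays bumped (set-scratch rep))
       then clear-correct (λ i → i))
      then λ { (ρ′ , rep′ , cleared , _) →
        inline-correct (Run.exec (runQ t)) (record
          { Represents rep′
          ; inner-regs = λ i → trans (inner-regs rep′ i) (cleared i) })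
      then λ rep″ → branch (inner-regs rep″ zero) (output _ rep″ verdict)
      then λ rep‴ → done e-set (_ , _ , erase-tape rep‴) })
      where
      final = Run.final (runQ t)

      bumped : ∀ {R : Vector ℕ N} → (R [ reg scratch ≔ 1 ]) (reg version) <
               (R [ reg scratch ≔ 1 ]) (reg version) + (R [ reg scratch ≔ 1 ]) (reg scratch)
      bumped {R} = let c = (R [ reg scratch ≔ 1 ]) (reg version) in
        ≤-reflexive (trans (+-comm 1 c) (cong (c +_) (sym (assign-same scratch))))

      verdict : nonZero (regs final zero) ≡ β
      verdict = decide L-β (correctQ t)
        where
        decide : ∀ {v β} → Reflects (L t) β → (v ≢ 0) ⇔ L t → nonZero v ≡ β
        decide {zero}  (ofʸ l)  iff = contradiction refl (Equivalence.from iff l)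
        decide {zero}  (ofⁿ _)  _   = refl
        decide {suc v} (ofʸ _)  _   = refl
        decide {suc v} (ofⁿ ¬l) iff = contradiction (Equivalence.to iff λ ()) ¬l

      output : ∀ {S ρ α w} v → Represents ⟨ r , z , t ⟩ ρ α S → nonZero v ≡ β →
        Reaches w (if nonZero v then set (reg (outer x)) 1 else set (reg (outer x)) 0) S
          (Represents ⟨ r [ x ≔ (if β then 1 else 0) ] , z , t ⟩ ρ α) 1
      output zero    rep refl = done e-set (set-outer x refl rep)
      output (suc _) rep refl = done e-set (set-outer x refl rep)

    append-correct : ∀ x → Represents ⟨ r , z , t ⟩ ρ α S →
      Reaches w (append x) S (Implements ⟨ r , z , t ∷ʳ nonZero (r x) ⟩) 5
    append-correct {r = r} {z = z} {t = t} {ρ = ρ} {α = α} x rep =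
      branch (outer-regs rep x) (symbol-correct (r x) rep)
      then λ { (rep′ , eq) →
        done (e-seq (e-seq e-store e-set) e-add)
          (_ , _ , extend-tape (nonZero (r x)) (tape-length rep′) eq
            (trans (cong₂ _+_ (trans (assign-other tapeLength scratch λ ()) (tape-length rep′))
                              (assign-same scratch))
                   (+-comm (length t) 1))
            (set-scratch rep′)) }
      where
      symbol-correct : ∀ {S w} v → Represents ⟨ r , z , t ⟩ ρ α S →
        Reaches w (if nonZero v then set (reg scratch) 2 else set (reg scratch) 1) S
          (λ S′ → Represents ⟨ r , z , t ⟩ ρ α S′ × regs S′ (reg scratch) ≡ symbol (nonZero v)) 1
      symbol-correct zero    rep = done e-set (set-scratch rep , assign-same scratch)
      symbol-correct (suc _) rep = done e-set (set-scratch rep , assign-same scratch)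

    -- The fixed part of a query, `(2 + suc b) + 3`; it also covers the 5 steps of `append` and the
    -- single step of every other basic command.
    overhead : ℕ
    overhead = 6 + b

    queryTime : List Word → ℕ
    queryTime qs = 4 * sum (List.map (time ∘ runQ) qs)

    queryTime-++ : ∀ ps qs → queryTime (ps ++ qs) ≡ queryTime ps + queryTime qs
    queryTime-++ ps qs = begin
      4 * sum (List.map (time ∘ runQ) (ps ++ qs))  ≡⟨ cong (λ ts → 4 * sum ts) (map-++ (time ∘ runQ) ps qs) ⟩
      4 * sum (List.map (time ∘ runQ) ps ++ List.map (time ∘ runQ) qs)
        ≡⟨ cong (4 *_) (sum-++ (List.map (time ∘ runQ) ps) _) ⟩
      4 * (sum (List.map (time ∘ runQ) ps) + sum (List.map (time ∘ runQ) qs))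
        ≡⟨ *-distribˡ-+ 4 (sum (List.map (time ∘ runQ) ps)) _ ⟩
      queryTime ps + queryTime qs                  ∎
      where open ≡-Reasoning

    budget : ℕ → List Word → ℕ
    budget T qs = overhead * T + queryTime qs

    budget-+ : ∀ T U ps qs → budget T ps + budget U qs ≡ budget (T + U) (ps ++ qs)
    budget-+ T U ps qs rewrite queryTime-++ ps qs = identity overhead T U (queryTime ps) (queryTime qs)
      where
      identity : ∀ d T U p q → (d * T + p) + (d * U + q) ≡ d * (T + U) + (p + q)
      identity = solve-∀

    suc-budget : ∀ T qs → suc (budget T qs) ≤ budget (suc T) qs
    suc-budget T qs = +-monoˡ-≤ (queryTime qs)
      (subst (suc (overhead * T) ≤_) (sym (*-suc overhead T)) (s≤s (m≤n+m (overhead * T) (5 + b))))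

    step : i ≤ overhead → Reaches w C S Φ i → Reaches w C S Φ (budget 1 [])
    step i≤ = relax (≤-trans i≤ (≤-reflexive (sym (trans (+-identityʳ _) (*-identityʳ overhead)))))

    compile-correct : ∀ {κ} {c : Cmd a m κ} {s s′ T qs} → Exec L w c s s′ T qs → Implements s S →
      Reaches w (compile c) S (Implements s′) (budget T qs)
    compile-correct e-skip rep = relax z≤n (done e-skip rep)
    compile-correct e-set (_ , _ , rep) = step (s≤s z≤n) (done e-set (_ , _ , set-outer _ refl rep))
    compile-correct (e-add {y = y} {z}) (_ , _ , rep) = step (s≤s z≤n)
      (done e-add (_ , _ , set-outer _ (cong₂ _+_ (outer-regs rep y) (outer-regs rep z)) rep))
    compile-correct (e-sub {y = y} {z}) (_ , _ , rep) = step (s≤s z≤n)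
      (done e-sub (_ , _ , set-outer _ (cong₂ _∸_ (outer-regs rep y) (outer-regs rep z)) rep))
    compile-correct (e-half {y = y}) (_ , _ , rep) = step (s≤s z≤n)
      (done e-half (_ , _ , set-outer _ (cong ⌊_/2⌋ (outer-regs rep y)) rep))
    compile-correct (e-load {α = α} {a = i} {y}) (_ , _ , rep) = step (s≤s z≤n)
      (done e-load (_ , _ ,
        set-outer _ (trans (outer-arrays rep i _) (cong (α i) (outer-regs rep y))) rep))
    compile-correct (e-store {a = i} {x} {y}) (_ , _ , rep) = step (s≤s z≤n)
      (done e-store (_ , _ , store-outer i (outer-regs rep x) (outer-regs rep y) rep))
    compile-correct {w = w} (e-read {y = y}) (_ , _ , rep) = step (s≤s z≤n)
      (done e-read (_ , _ , set-outer _ (cong (letter w) (outer-regs rep y)) rep))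
    compile-correct e-len (_ , _ , rep) = step (s≤s z≤n) (done e-len (_ , _ , set-outer _ refl rep))
    compile-correct (e-seq {t = t} {u} {ps} {qs} e e′) rep =
      relax (≤-reflexive (budget-+ t u ps qs)) (compile-correct e rep then compile-correct e′)
    compile-correct (e-if {x = x} {ρ = r} {t = t} {qs = qs} e) rep@(_ , _ , rep′) =
      relax (suc-budget t qs)
        (branch (outer-regs rep′ x)
          (subst (λ C → Reaches _ C _ _ _) (compile-if (nonZero (r x))) (compile-correct e rep)))
    compile-correct (e-while {x = x} {ρ = r} {t = t} {qs = qs} e) rep@(_ , _ , rep′) =
      relax (suc-budget t qs)
        (loop (outer-regs rep′ x)
          (subst (λ C → Reaches _ C _ _ _) (compile-if (nonZero (r x))) (compile-correct e rep)))
    compile-correct (e-emit {x = x}) (_ , _ , rep) = step (s≤s (s≤s (s≤s (s≤s (s≤s z≤n))))) (append-correct x rep)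
    compile-correct (e-query {τ = v} {x = x} L-β) (_ , _ , rep) =
      relax (≤-reflexive (identity b (time (runQ v)))) (answer-correct x L-β rep)
      where
      identity : ∀ b t → (2 + suc b) + (4 * t + 3) ≡ (6 + b) * 1 + 4 * (t + 0)
      identity = solve-∀

-- Numbering the registers and arrays of the host

registerIndex : ∀ {a b} → Register a b → Fin (a + (b + 3))
registerIndex {a} {b} (outer i)  = i ↑ˡ (b + 3)
registerIndex {a} {b} (inner i)  = a ↑ʳ (i ↑ˡ 3)
registerIndex {a} {b} version    = a ↑ʳ (b ↑ʳ zero)
registerIndex {a} {b} tapeLength = a ↑ʳ (b ↑ʳ suc zero)
registerIndex {a} {b} scratch    = a ↑ʳ (b ↑ʳ suc (suc zero))

-- A left inverse of `registerIndex`, which yields injectivity without comparing constructors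
-- pairwise.
registerAt : ∀ {a b} → Fin (a + (b + 3)) → Register a b
registerAt {a} {b} = [ outer , [ inner , lookup (version ∷ tapeLength ∷ scratch ∷ []) ]′ ∘ splitAt b ]′ ∘ splitAt a

registerAt-index : ∀ {a b} (x : Register a b) → registerAt (registerIndex x) ≡ x
registerAt-index {a} {b} (outer i)  rewrite Fin.splitAt-↑ˡ a i (b + 3) = refl
registerAt-index {a} {b} (inner i)  rewrite Fin.splitAt-↑ʳ a (b + 3) (i ↑ˡ 3) | Fin.splitAt-↑ˡ b i 3 = refl
registerAt-index {a} {b} version
  rewrite Fin.splitAt-↑ʳ a (b + 3) (b ↑ʳ zero) | Fin.splitAt-↑ʳ b 3 zero = refl
registerAt-index {a} {b} tapeLength
  rewrite Fin.splitAt-↑ʳ a (b + 3) (b ↑ʳ suc zero) | Fin.splitAt-↑ʳ b 3 (suc zero) = refl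
registerAt-index {a} {b} scratch
  rewrite Fin.splitAt-↑ʳ a (b + 3) (b ↑ʳ suc (suc zero)) | Fin.splitAt-↑ʳ b 3 (suc (suc zero)) = refl

arrayIndex : ∀ {m n} → Array m n → Fin (m + (n + (n + 1)))
arrayIndex {m} {n} (outer i)   = i ↑ˡ (n + (n + 1))
arrayIndex {m} {n} (content i) = m ↑ʳ (i ↑ˡ (n + 1))
arrayIndex {m} {n} (stamp i)   = m ↑ʳ (n ↑ʳ (i ↑ˡ 1))
arrayIndex {m} {n} tapeArray   = m ↑ʳ (n ↑ʳ (n ↑ʳ zero))

arrayAt : ∀ {m n} → Fin (m + (n + (n + 1))) → Array m n
arrayAt {m} {n} =
  [ outer , [ content , [ stamp , const tapeArray ]′ ∘ splitAt n ]′ ∘ splitAt n ]′ ∘ splitAt m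

arrayAt-index : ∀ {m n} (x : Array m n) → arrayAt (arrayIndex x) ≡ x
arrayAt-index {m} {n} (outer i) rewrite Fin.splitAt-↑ˡ m i (n + (n + 1)) = refl
arrayAt-index {m} {n} (content i)
  rewrite Fin.splitAt-↑ʳ m (n + (n + 1)) (i ↑ˡ (n + 1)) | Fin.splitAt-↑ˡ n i (n + 1) = refl
arrayAt-index {m} {n} (stamp i)
  rewrite Fin.splitAt-↑ʳ m (n + (n + 1)) (n ↑ʳ (i ↑ˡ 1)) | Fin.splitAt-↑ʳ n (n + 1) (i ↑ˡ 1)
        | Fin.splitAt-↑ˡ n i 1 = refl
arrayAt-index {m} {n} tapeArray
  rewrite Fin.splitAt-↑ʳ m (n + (n + 1)) (n ↑ʳ (n ↑ʳ zero)) | Fin.splitAt-↑ʳ n (n + 1) (n ↑ʳ zero)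
        | Fin.splitAt-↑ʳ n 1 zero = refl

retract⇒injective : ∀ {A B : Set} (f : A → B) (g : B → A) → (∀ x → g (f x) ≡ x) → Injective _≡_ _≡_ f
retract⇒injective f g gf {x} {y} eq = trans (sym (gf x)) (trans (cong g eq) (gf y))

-- Bounds on the number and cost of queries

-- Only finitely many words are this short; `E` is the sum of `t` over them, collected along the
-- binary tree of words.
bounded-on-short : ∀ n (t : Word → ℕ) → ∃[ E ] (∀ w → length w < n → t w ≤ E)
bounded-on-short zero    t = 0 , λ _ ()
bounded-on-short (suc n) t with bounded-on-short n (t ∘ (false ∷_)) | bounded-on-short n (t ∘ (true ∷_))
... | E₀ , ≤E₀ | E₁ , ≤E₁ = t [] + (E₀ + E₁) , λ where
  []          _         → m≤m+n _ _
  (false ∷ w) (s≤s w<n) → ≤-trans (≤E₀ w w<n) (≤-trans (m≤m+n _ _) (m≤n+m _ (t [])))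
  (true  ∷ w) (s≤s w<n) → ≤-trans (≤E₁ w w<n) (≤-trans (m≤n+m _ E₀) (m≤n+m _ (t [])))

queries≤time : ∀ {O w r m κ} {c : Cmd r m κ} {s s′ t qs} → Exec O w c s s′ t qs → length qs ≤ t
queries≤time e-skip      = z≤n
queries≤time e-set       = z≤n
queries≤time e-add       = z≤n
queries≤time e-sub       = z≤n
queries≤time e-half      = z≤n
queries≤time e-load      = z≤n
queries≤time e-store     = z≤n
queries≤time e-read      = z≤n
queries≤time e-len       = z≤n
queries≤time (e-seq {ps = ps} e e′) =
  ≤-trans (≤-reflexive (length-++ ps)) (+-mono-≤ (queries≤time e) (queries≤time e′))
queries≤time (e-if e)    = m≤n⇒m≤1+n (queries≤time e)
queries≤time (e-while e) = m≤n⇒m≤1+n (queries≤time e)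
queries≤time e-emit      = z≤n
queries≤time (e-query _) = s≤s z≤n

-- The hypothesis ranges over positions because the parameter bounds are known only for words
-- actually submitted as queries.
sum-map-affine : ∀ {A : Set} (t s : A → ℕ) E k xs →
  (∀ j → t (List.lookup xs j) ≤ E + k * s (List.lookup xs j)) →
  sum (List.map t xs) ≤ E * length xs + k * sum (List.map s xs)
sum-map-affine t s E k []       _  = z≤n
sum-map-affine t s E k (x ∷ xs) t≤ = ≤-trans
  (+-mono-≤ (t≤ zero) (sum-map-affine t s E k xs (t≤ ∘ suc)))
  (≤-reflexive (identity E k (s x) (length xs) (sum (List.map s xs))))
  where
  identity : ∀ E k a l b → (E + k * a) + (E * l + k * b) ≡ E * suc l + k * (a + b)
  identity = solve-∀

restrict-≤ : ∀ {n H} (Λ : Subset n) (xs : Vec ℕ n) → (∀ i → i ∈ Λ → lookup xs i ≤ H) → All (_≤ H) (restrict Λ xs)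
restrict-≤ []            []       _  = []
restrict-≤ (inside  ∷ Λ) (x ∷ xs) ≤H = ≤H zero Vec.here ∷ restrict-≤ Λ xs (λ i → ≤H (suc i) ∘ Vec.there)
restrict-≤ (outside ∷ Λ) (x ∷ xs) ≤H = restrict-≤ Λ xs (λ i → ≤H (suc i) ∘ Vec.there)

-- The composed algorithm and its running time

module Composition (A B : ParameterizedProblem) (red : A ≤PFG B) (Λ : Subset (arity B)) (fpi : FPI B Λ) where
  private
    module R = _≤PFG_ red
    module Q = FPI fpi
    module RP = Program R.program
    module QP = Program Q.program

  open Simulation {suc RP.nRegs} {QP.nRegs} {RP.nArrays} {QP.nArrays}
    registerIndex (retract⇒injective registerIndex registerAt registerAt-index)
    arrayIndex (retract⇒injective arrayIndex arrayAt arrayAt-index)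
  open Oracle QP.body (language B) Q.run Q.correct

  composed : Program plain
  composed = record { body = compile RP.body }

  simulated : ∀ w → Reaches w (compile RP.body) initial (Implements (Run.final (R.run w)))
                      (budget (time (R.run w)) (queries (R.run w)))
  simulated w = compile-correct (Run.exec (R.run w))
    (const 0 , (λ _ _ → 0) , represents (λ _ → refl) (λ _ → refl) (λ _ _ → refl)
      -- Version and stamps all start at 0, so every cell counts as fresh, and it correctly stores
      -- 0.
      (λ _ _ → cell z≤n (λ _ → refl) (λ _ → refl)) refl (λ ()))

  composedRun : ∀ w → Run composed noOracle w
  composedRun w = record { exec = Reaches.exec (simulated w) }

  composed-correct : ∀ w → Accepting (composedRun w) ⇔ language A w
  composed-correct w with Reaches.post (simulated w)
  ... | _ , _ , rep = mk⇔
    (λ accepts → Equivalence.to (R.correct w) (accepts ∘ trans (Represents.outer-regs rep zero)))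
    (λ member → Equivalence.from (R.correct w) member ∘ trans (sym (Represents.outer-regs rep zero)))

  answers-bound : ∀ K → Suffices red Λ K →
    Σ[ H ∈ (Vec ℕ ∣ K ∣ → ℕ) ] Computable H ×
    (∀ w j → Q.f (restrict Λ (params B (List.lookup (queries (R.run w)) j))) ≤ H (restrict K (params A w)))
  answers-bound K (h , (p , p-correct) , g≤h) with majorant Q.f Q.f-computable
  ... | F , (q , q-correct) , f≤F =
    (λ xs → F (h xs ∷ []))
    , (comp q (p ∷ []) , λ xs → ⇓comp (p-correct xs ∷ []) (q-correct _))
    , λ w j → f≤F _ _ (restrict-≤ Λ _ λ i i∈Λ →
        ≤-trans (≤-reflexive (lookup∘tabulate (λ i → param B i _) i))
          (≤-trans (R.g-bounds w j i) (g≤h w j i i∈Λ)))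

  composed-FPI : ∀ K → Suffices red Λ K → FPI A K
  composed-FPI K suff
    with H , (p , p-correct) , f≤H ← answers-bound K suff
       | C , n₁ , Q-efficient ← Q.efficient
       -- The reduction is instantiated at the very saving achieved by the algorithm for B; the
       -- resulting `δ` is the saving for A.
       | δ , δ-saving , c , n₀ , R-efficient ← R.efficient Q.ε Q.saving
    with E , short≤E ← bounded-on-short n₁ (time ∘ Q.run)
    = record
    { program      = composed
    ; run          = composedRun
    ; correct      = composed-correct
    ; ε            = δ
    ; saving       = δ-saving
    -- The successor keeps the factor positive: the steps of the reduction and the short queries are
    -- charged without a factor `H`, which may be 0.
    ; f            = suc ∘ H
    ; f-computable = comp sucᶠ (p ∷ []) , λ xs → ⇓comp (p-correct xs ∷ []) ⇓suc
    -- The three summands pay for the steps of the reduction, the short queries and the long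
    -- queries.
    ; efficient    = overhead * c + 4 * (E * c) + 4 * (C * c) , n₀ , efficient
    }
    where
    -- Adding `E` to the asymptotic bound covers short and long queries at once, so they need not be
    -- separated in the sum.
    query-time : ∀ w j → let q = List.lookup (queries (R.run w)) j in
      time (Q.run q) ≤ E + (C * H (restrict K (params A w))) * saved B Q.ε q
    query-time w j with List.lookup (queries (R.run w)) j | f≤H w j
    ... | q | f≤ with length q <? n₁
    ...   | yes short = ≤-trans (short≤E q short) (m≤m+n E _)
    ...   | no ¬short = begin
      time (Q.run q)                    ≤⟨ Q-efficient q (≮⇒≥ ¬short) ⟩
      C * (saved B Q.ε q * Q.f _)       ≤⟨ *-monoʳ-≤ C (*-monoʳ-≤ (saved B Q.ε q) f≤) ⟩
      C * (saved B Q.ε q * H _)         ≡⟨ cong (C *_) (*-comm (saved B Q.ε q) _) ⟩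
      C * (H _ * saved B Q.ε q)         ≡⟨ sym (*-assoc C _ _) ⟩
      (C * H _) * saved B Q.ε q         ≤⟨ m≤n+m _ E ⟩
      E + (C * H _) * saved B Q.ε q     ∎
      where open ≤-Reasoning

    efficient : ∀ w → n₀ ≤ length w → time (composedRun w) ≤
      (overhead * c + 4 * (E * c) + 4 * (C * c)) * (saved A δ w * suc (H (restrict K (params A w))))
    efficient w long with R-efficient w long
    ... | T≤ , Σ≤ = begin
      time (composedRun w)                              ≤⟨ Reaches.within (simulated w) ⟩
      overhead * T + 4 * sum (List.map (time ∘ Q.run) qs)
        ≤⟨ +-monoʳ-≤ (overhead * T) (*-monoʳ-≤ 4 (sum-map-affine _ (saved B Q.ε) E (C * x) qs (query-time w))) ⟩
      overhead * T + 4 * (E * length qs + C * x * sum (List.map (saved B Q.ε) qs))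
        ≤⟨ +-mono-≤ (*-monoʳ-≤ overhead T≤) (*-monoʳ-≤ 4 (+-mono-≤
             (*-monoʳ-≤ E (≤-trans (queries≤time (Run.exec (R.run w))) T≤))
             (*-monoʳ-≤ (C * x) Σ≤))) ⟩
      overhead * (c * a) + 4 * (E * (c * a) + C * x * (c * a))
        -- The added terms are exactly those missing from the expansion of the target product: `x`
        -- times the first two contributions, and the third one without its factor `x`.
        ≤⟨ m≤m+n _ _ ⟩
      overhead * (c * a) + 4 * (E * (c * a) + C * x * (c * a))
        + (overhead * (c * a) * x + 4 * (E * (c * a) * x) + 4 * (C * (c * a)))
        ≡⟨ identity overhead c a E C x ⟩
      (overhead * c + 4 * (E * c) + 4 * (C * c)) * (a * suc x) ∎
      where
      open ≤-Reasoning
      T  = time (R.run w)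
      qs = queries (R.run w)
      a  = saved A δ w
      x  = H (restrict K (params A w))

      identity : ∀ d c a E C x →
        d * (c * a) + 4 * (E * (c * a) + C * x * (c * a))
          + (d * (c * a) * x + 4 * (E * (c * a) * x) + 4 * (C * (c * a)))
        ≡ (d * c + 4 * (E * c) + 4 * (C * c)) * (a * suc x)
      identity = solve-∀

mainTheorem4 : (A B : ParameterizedProblem) (red : A ≤PFG B) (Λ : Subset (arity B)) → FPI B Λ → (K : Subset (arity A)) → IsMinimumNecessary red Λ K → FPI A K
mainTheorem4 A B red Λ fpi K (suff , _) = Composition.composed-FPI A B red Λ fpi K suff
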